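{- Let $p$ be an odd prime. Then $D_{Q_p,\mathbf 1}=4$ or $D_{Q_p,\mathbf 1}=5$.
   Context: For an odd prime $p$, $\mathbb Z_p=\mathbb Z/p\mathbb Z$, $U(p)$ is its group of units, and $Q_p=\{x^2:x\in U(p)\}$. A sequence of length $k$ in $\mathbb Z_p$ is an element of $\mathbb Z_p^k$. A sequence $(x_1,\ldots,x_k)$ in $\mathbb Z_p$ is called a $(Q_p,\mathbf 1)$-weighted zero-sum sequence if there exist $a_1,\ldots,a_k\in Q_p$ such that $a_1x_1+\cdots+a_kx_k=0$ and $a_1+\cdots+a_k=0$ in $\mathbb Z_p$. The constant $D_{Q_p,\mathbf 1}$ is the least positive integer $k$ such that every sequence in $\mathbb Z_p$ of length $k$ has a (non-empty) $(Q_p,\mathbf 1)$-weighted zero-sum subsequence (terms not necessarily consecutive). -}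

module Defs where

open import Algebra.Definitions using (Invertible)
open import Data.Fin.Base using (Fin; toℕ)
open import Data.List.Relation.Binary.Sublist.Propositional using (_⊆_)
open import Data.Nat.Base as ℕ using (ℕ; NonZero; _≤_)
open import Data.Nat.DivMod using (_mod_)
open import Data.Product.Base using (∃-syntax; _×_)
open import Data.Vec.Base using (Vec; foldr′; zipWith; toList)
open import Data.Vec.Relation.Unary.All using (All)
open import Relation.Binary.PropositionalEquality.Core using (_≡_)

IsLeastPositive : (ℕ → Set) → ℕ → Set
IsLeastPositive P k = 1 ≤ k × P k × (∀ j → 1 ≤ j → P j → k ≤ j)

module _ (p : ℕ) .{{_ : NonZero p}} where

  -- ℤ/pℤ, each residue class being given by its representative in
  -- {0, …, p-1}, with addition and multiplication modulo p.
  ℤₚ : Set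
  ℤₚ = Fin p

  0ₚ 1ₚ : ℤₚ
  0ₚ = 0 mod p
  1ₚ = 1 mod p

  addₚ mulₚ : ℤₚ → ℤₚ → ℤₚ
  addₚ x y = (toℕ x ℕ.+ toℕ y) mod p
  mulₚ x y = (toℕ x ℕ.* toℕ y) mod p

  sumₚ : ∀ {k} → Vec ℤₚ k → ℤₚ
  sumₚ = foldr′ addₚ 0ₚ

  IsUnit : ℤₚ → Set
  IsUnit = Invertible _≡_ 1ₚ mulₚ

  Q : ℤₚ → Set
  Q a = ∃[ x ] IsUnit x × a ≡ mulₚ x x

  IsWeightedZeroSum : ∀ {k} → Vec ℤₚ k → Set
  IsWeightedZeroSum {k} xs =
    ∃[ as ] All Q {k} as × sumₚ (zipWith mulₚ as xs) ≡ 0ₚ × sumₚ as ≡ 0ₚ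

  -- The library's _⊆_ on lists deletes terms and preserves the order of the
  -- others; NonZero m makes the subsequence non-empty.
  HasWeightedZeroSumSubsequence : ∀ {k} → Vec ℤₚ k → Set
  HasWeightedZeroSumSubsequence xs =
    ∃[ m ] ∃[ ys ] NonZero m × toList {n = m} ys ⊆ toList xs × IsWeightedZeroSum ys

  -- "D_{Q_p,𝟏} = k".  The constant is given by its graph, since its definition
  -- as a minimum yields a value only once some such k is known to exist.
  IsDQ𝟏 : ℕ → Set
  IsDQ𝟏 = IsLeastPositive λ k → (xs : Vec ℤₚ k) → HasWeightedZeroSumSubsequence xs

{-# OPTIONS --safe #-}
module Submission where

-- The squares of ℤ/p are exactly Q_p ∪ {0}, so a sequence x has a weighted
-- zero-sum subsequence iff the forms f = Σ xᵢ zᵢ² and g = Σ zᵢ² have a common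
-- nontrivial zero.  With five variables one exists by the Chevalley–Warning
-- argument: ∏_{0<i<p} (f + i)(g + i) has degree 4(p − 1) < 5(p − 1), so its values
-- over (ℤ/p)⁵ add up to 0 mod p, yet it vanishes mod p off the common zeros and
-- not at the origin.  With three variables (0, 1, t) has none when −t is a
-- non-square.  Whether four variables suffice is settled by finite search.

open import Defs
open import Data.Fin.Base using (Fin; zero; suc; toℕ; fromℕ; inject₁; punchOut)
open import Data.Fin.Properties
  using (any?; ¬∀⟶∃¬; toℕ-injective; toℕ-fromℕ<; toℕ-fromℕ; toℕ-inject₁; toℕ<n
        ; punchOut-injective; <⇒notInjective)
  renaming (_≟_ to _≟ᶠ_)
open import Data.List.Relation.Binary.Sublist.Propositional using (_⊆_; []; _∷_; _∷ʳ_)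
open import Data.Nat.Base
  using (ℕ; zero; suc; _+_; _*_; _∸_; _≤_; _<_; z≤n; s≤s; NonZero)
open import Data.Nat.Coprimality using (prime⇒coprime; coprime-Bézout)
open import Data.Nat.Divisibility
open import Data.Nat.DivMod
open import Data.Nat.GCD using (module Bézout)
open import Data.Nat.Primality using (Prime; ¬prime[0]; ¬prime[1]; euclidsLemma)
open import Data.Nat.Properties
open import Data.Nat.Tactic.RingSolver using (solve-∀)
open import Data.Product.Base using (∃; ∃-syntax; _×_; _,_; proj₁; proj₂; map₂)
open import Data.Sum.Base using (_⊎_; inj₁; inj₂; [_,_]′)
open import Data.Vec.Base as Vec using (Vec; []; _∷_; lookup; map; replicate; toList; zipWith; updateAt)
open import Data.Vec.Relation.Unary.All using (All; []; _∷_)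
open import Data.Vec.Relation.Unary.Any as Any using (Any; here; there)
open import Function.Base using (_∘_; _$_)
open import Relation.Binary.PropositionalEquality
open import Relation.Nullary using (¬_; Dec; yes; no; contradiction; ¬?; _×-dec_)
open import Relation.Nullary.Decidable using (map′; decidable-stable)
open import Relation.Unary using (Decidable)

open import Algebra.Properties.Semiring.Sum +-*-semiring
  using (sum; sum-cong-≗; ∑-distrib-+; *-distribˡ-sum; *-distribʳ-sum; sum-init-last)

-- Falling factorials and their sums.

-- The product m(m - 1)⋯(m - k + 1), which is 0 when k > m. It replaces the power m^k because its
-- sums telescope.
falling : ℕ → ℕ → ℕ
falling m       zero    = 1
falling zero    (suc k) = 0
falling (suc m) (suc k) = suc m * falling m k

-- Write m as (m - k) + k. The additive form avoids truncated subtraction; for m < k both sides are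
-- 0.
*-falling : ∀ m k → m * falling m k ≡ falling m (suc k) + k * falling m k
*-falling zero    zero    = refl
*-falling zero    (suc k) = sym (*-zeroʳ (suc k))
*-falling (suc m) zero    = sym (+-identityʳ _)
*-falling (suc m) (suc k) = begin
  suc m * (suc m * F)                   ≡⟨⟩
  suc m * (F + m * F)                   ≡⟨ cong (λ x → suc m * (F + x)) (*-falling m k) ⟩
  suc m * (F + (G + k * F))             ≡⟨ expand m k F G ⟩
  suc m * G + suc k * (suc m * F)       ∎
  where
  open ≡-Reasoning
  F = falling m k
  G = falling m (suc k)
  expand : ∀ m k F G → suc m * (F + (G + k * F)) ≡ suc m * G + suc k * (suc m * F)
  expand = solve-∀

-- The discrete derivative of a falling factorial, which makes the sum below telescope.
falling-suc : ∀ m k → falling (suc m) (suc k) ≡ falling m (suc k) + suc k * falling m k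
falling-suc m k = begin
  F + m * F                       ≡⟨ cong (F +_) (*-falling m k) ⟩
  F + (falling m (suc k) + k * F) ≡⟨ swap F (falling m (suc k)) (k * F) ⟩
  falling m (suc k) + (F + k * F) ∎
  where
  open ≡-Reasoning
  F = falling m k
  swap : ∀ a b c → a + (b + c) ≡ b + (a + c)
  swap = solve-∀

sum-falling : ∀ n k → suc k * sum {n} (λ i → falling (toℕ i) k) ≡ falling n (suc k)
sum-falling zero    k = *-zeroʳ (suc k)
sum-falling (suc n) k = begin
  suc k * sum {suc n} (λ i → falling (toℕ i) k)
    ≡⟨ cong (suc k *_) (sum-init-last {n} (λ i → falling (toℕ i) k)) ⟩
  suc k * (sum {n} (λ i → falling (toℕ (inject₁ i)) k) + falling (toℕ (fromℕ n)) k)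
    ≡⟨ cong (suc k *_) (cong₂ _+_
         (sum-cong-≗ {n} (λ i → cong (λ m → falling m k) (toℕ-inject₁ i)))
         (cong (λ m → falling m k) (toℕ-fromℕ n))) ⟩
  suc k * (sum {n} (λ i → falling (toℕ i) k) + falling n k)
    ≡⟨ *-distribˡ-+ (suc k) (sum {n} (λ i → falling (toℕ i) k)) (falling n k) ⟩
  suc k * sum {n} (λ i → falling (toℕ i) k) + suc k * falling n k
    ≡⟨ cong (_+ suc k * falling n k) (sum-falling n k) ⟩
  falling n (suc k) + suc k * falling n k
    ≡⟨ falling-suc n k ⟨
  falling (suc n) (suc k) ∎
  where open ≡-Reasoning

-- Rising products, a pigeonhole principle and finite search.

-- The product (m + 1)⋯(m + r). For p prime and r = p - 1 it is divisible by p exactly when m is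
-- not, so it plays the part of 1 - m^(p-1) in the usual Chevalley-Warning proof.
rise : ℕ → ℕ → ℕ
rise zero    m = 1
rise (suc r) m = (m + suc r) * rise r m

+∣rise : ∀ m {i r} → i < r → m + suc i ∣ rise r m
+∣rise m {i} {suc r} i<1+r with m<1+n⇒m<n∨m≡n i<1+r
... | inj₁ i<r  = ∣n⇒∣m*n (m + suc r) (+∣rise m i<r)
... | inj₂ refl = m∣m*n (rise r m)

∣sum : ∀ {d n} (g : Fin n → ℕ) → (∀ i → d ∣ g i) → d ∣ sum g
∣sum {d} {zero}  g d∣g = d ∣0
∣sum {d} {suc n} g d∣g = ∣m∣n⇒∣m+n (d∣g zero) (∣sum (g ∘ suc) (d∣g ∘ suc))

-- If `f` were surjective, a section of it would choose only one preimage of `f a` ≡ `f b`, hence be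
-- an injection of `Fin n` into itself that avoids `a` or `b`.
missed-value : ∀ {n} (f : Fin n → Fin n) {a b} → a ≢ b → f a ≡ f b → ∃[ t ] ∀ x → f x ≢ t
missed-value {suc n} f {a} {b} a≢b fa≡fb =
  map₂ (λ ¬hit x fx≡t → ¬hit (x , fx≡t))
    (¬∀⟶∃¬ (suc n) (λ t → ∃[ x ] f x ≡ t) (λ t → any? (λ x → f x ≟ᶠ t)) ¬surjective)
  where
  ¬surjective : ¬ (∀ t → ∃[ x ] f x ≡ t)
  ¬surjective surj = unhit (s (f a) ≟ᶠ a)
    where
    s : Fin (suc n) → Fin (suc n)
    s = proj₁ ∘ surj
    f∘s : ∀ t → f (s t) ≡ t
    f∘s = proj₂ ∘ surj
    -- An injective s cannot avoid a value, since then it would map into Fin n.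
    hits : ∀ e → ¬ (∀ i → e ≢ s i)
    hits e e≢s = <⇒notInjective {f = λ i → punchOut (e≢s i)} (n<1+n n) λ {i} {j} eq →
      trans (sym (f∘s i)) (trans (cong f (punchOut-injective (e≢s i) (e≢s j) eq)) (f∘s j))
    unhit : ¬ Dec (s (f a) ≡ a)
    unhit (yes sfa≡a) = hits b λ i b≡si → a≢b $ begin
      a         ≡⟨ sfa≡a ⟨
      s (f a)   ≡⟨ cong s fa≡fb ⟩
      s (f b)   ≡⟨ cong (s ∘ f) b≡si ⟩
      s (f (s i)) ≡⟨ cong s (f∘s i) ⟩
      s i       ≡⟨ b≡si ⟨
      b         ∎
      where open ≡-Reasoning
    unhit (no sfa≢a) = hits a λ i a≡si →
      sfa≢a (trans (cong s (trans (cong f a≡si) (f∘s i))) (sym a≡si))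

-- Finite search supplies the case distinctions and the proofs by contradiction used later.
any-vec? : ∀ {n k} {P : Vec (Fin n) k → Set} → Decidable P → Dec (∃ P)
any-vec? {k = zero}  P? = map′ (λ p → [] , p) (λ { ([] , p) → p }) (P? [])
any-vec? {k = suc k} P? =
  map′ (λ (x , xs , p) → x ∷ xs , p) (λ { (x ∷ xs , p) → x , xs , p })
    (any? (λ x → any-vec? (λ xs → P? (x ∷ xs))))

all-vec? : ∀ {n k} {P : Vec (Fin n) k → Set} → Decidable P → Dec (∀ xs → P xs)
all-vec? P? = map′ (λ ¬∃¬ xs → decidable-stable (P? xs) (λ ¬p → ¬∃¬ (xs , ¬p)))
  (λ ∀p (xs , ¬p) → ¬p (∀p xs)) (¬? (any-vec? (¬? ∘ P?)))

-- Arithmetic modulo p, and weighted sums as quadratic forms.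

module Residues (q : ℕ) where

  -- Written as q + 2, the modulus is visibly at least 2, and p - 1 is `suc q` without subtraction.
  p : ℕ
  p = suc (suc q)

  private
    variable
      k m : ℕ

  toℕ-mod : ∀ m → toℕ (m mod p) ≡ m % p
  toℕ-mod m = toℕ-fromℕ< (m%n<n m p)

  mod-cong : ∀ m n → m % p ≡ n % p → m mod p ≡ n mod p
  mod-cong m n eq = toℕ-injective (trans (toℕ-mod m) (trans eq (sym (toℕ-mod n))))

  mod-toℕ : (x : ℤₚ p) → toℕ x mod p ≡ x
  mod-toℕ x = toℕ-injective (trans (toℕ-mod (toℕ x)) (m<n⇒m%n≡m (toℕ<n x)))

  mod-+ : ∀ m n → (m + n) mod p ≡ addₚ p (m mod p) (n mod p)
  mod-+ m n = mod-cong (m + n) (toℕ (m mod p) + toℕ (n mod p)) (trans (%-distribˡ-+ m n p)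
    (cong₂ (λ x y → (x + y) % p) (sym (toℕ-mod m)) (sym (toℕ-mod n))))

  mod-* : ∀ m n → (m * n) mod p ≡ mulₚ p (m mod p) (n mod p)
  mod-* m n = mod-cong (m * n) (toℕ (m mod p) * toℕ (n mod p)) (trans (%-distribˡ-* m n p)
    (cong₂ (λ x y → (x * y) % p) (sym (toℕ-mod m)) (sym (toℕ-mod n))))

  ∣⇒mod≡0 : ∀ {m} → p ∣ m → m mod p ≡ 0ₚ p
  ∣⇒mod≡0 {m} p∣m = mod-cong m 0 (n∣m⇒m%n≡0 m p p∣m)

  mod≡0⇒∣ : ∀ {m} → m mod p ≡ 0ₚ p → p ∣ m
  mod≡0⇒∣ {m} eq = m%n≡0⇒n∣m m p (trans (sym (toℕ-mod m)) (cong toℕ eq))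

  addₚ-identityˡ : ∀ x → addₚ p (0ₚ p) x ≡ x
  addₚ-identityˡ = mod-toℕ

  square : ℤₚ p → ℤₚ p
  square x = mulₚ p x x

  unit≢0 : ∀ {x} → IsUnit p x → x ≢ 0ₚ p
  unit≢0 (y , yx≡1 , _) refl
    with () ← trans (sym yx≡1) (cong (_mod p) (*-zeroʳ (toℕ y)))

  weightedSum : Vec (ℤₚ p) k → Vec (ℤₚ p) k → ℤₚ p
  weightedSum as xs = sumₚ p (zipWith (mulₚ p) as xs)

  -- Evaluated in ℕ on representatives, so that polynomial identities hold exactly and p enters only
  -- through divisibility.
  quad : (Fin k → ℕ) → Vec (ℤₚ p) k → ℕ
  quad c zs = sum λ i → c i * (toℕ (lookup zs i) * toℕ (lookup zs i))

  coefficients : Vec (ℤₚ p) k → Fin k → ℕ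
  coefficients xs i = toℕ (lookup xs i)

  quad-replicate-0 : (c : Fin k → ℕ) → quad c (replicate k (0ₚ p)) ≡ 0
  quad-replicate-0 {zero}  c = refl
  quad-replicate-0 {suc k} c = cong₂ _+_ (*-zeroʳ (c zero)) (quad-replicate-0 (c ∘ suc))

  mod-quad : (xs zs : Vec (ℤₚ p) k) →
             quad (coefficients xs) zs mod p ≡ weightedSum (map square zs) xs
  mod-quad []       []       = refl
  mod-quad (x ∷ xs) (z ∷ zs) = begin
    (toℕ x * (toℕ z * toℕ z) + quad (coefficients xs) zs) mod p
      ≡⟨ mod-+ (toℕ x * (toℕ z * toℕ z)) _ ⟩
    addₚ p ((toℕ x * (toℕ z * toℕ z)) mod p) (quad (coefficients xs) zs mod p)
      ≡⟨ cong₂ (addₚ p) head (mod-quad xs zs) ⟩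
    addₚ p (mulₚ p (square z) x) (weightedSum (map square zs) xs) ∎
    where
    open ≡-Reasoning
    head : (toℕ x * (toℕ z * toℕ z)) mod p ≡ mulₚ p (square z) x
    head = trans (cong (_mod p) (*-comm (toℕ x) (toℕ z * toℕ z)))
      (trans (mod-* (toℕ z * toℕ z) (toℕ x)) (cong (mulₚ p (square z)) (mod-toℕ x)))

  mod-quad-1 : (zs : Vec (ℤₚ p) k) → quad (λ _ → 1) zs mod p ≡ sumₚ p (map square zs)
  mod-quad-1 []       = refl
  mod-quad-1 (z ∷ zs) = trans (mod-+ (1 * (toℕ z * toℕ z)) _)
    (cong₂ (addₚ p) (cong (_mod p) (*-identityˡ (toℕ z * toℕ z))) (mod-quad-1 zs))

  -- The squares are Q ∪ {0}; a zero coordinate marks a term outside the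
  -- subsequence.
  CommonZero : Vec (ℤₚ p) k → Vec (ℤₚ p) k → Set
  CommonZero xs zs =
    Any (_≢ 0ₚ p) zs × p ∣ quad (coefficients xs) zs × p ∣ quad (λ _ → 1) zs

  -- Square roots of the weights, padded with 0 at omitted terms. The sums are compared rather than
  -- set to 0, because the tails met in the induction need not sum to 0.
  ExtendedWeights : Vec (ℤₚ p) k → Vec (ℤₚ p) m → Vec (ℤₚ p) m → Set
  ExtendedWeights {m = m} xs ys as = ∃[ zs ]
    weightedSum (map square zs) xs ≡ weightedSum as ys
    × sumₚ p (map square zs) ≡ sumₚ p as
    × (NonZero m → Any (_≢ 0ₚ p) zs)

  skipTerm : {xs : Vec (ℤₚ p) k} (x : ℤₚ p) (ys as : Vec (ℤₚ p) m) →
             ExtendedWeights xs ys as → ExtendedWeights (x ∷ xs) ys as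
  skipTerm x ys as (zs , eq₁ , eq₂ , nz) =
    0ₚ p ∷ zs , trans (addₚ-identityˡ _) eq₁ , trans (addₚ-identityˡ _) eq₂ , there ∘ nz

  extendWeights : (xs : Vec (ℤₚ p) k) (ys as : Vec (ℤₚ p) m) →
    toList ys ⊆ toList xs → All (Q p) as → ExtendedWeights xs ys as
  extendWeights []       []       []       []        []  = [] , refl , refl , λ ()
  extendWeights (x ∷ xs) []       as       (_ ∷ʳ s)  qs  = skipTerm x [] as (extendWeights xs [] as s qs)
  extendWeights (x ∷ xs) (y ∷ ys) as       (_ ∷ʳ s)  qs  =
    skipTerm x (y ∷ ys) as (extendWeights xs (y ∷ ys) as s qs)
  extendWeights (x ∷ xs) (_ ∷ ys) (_ ∷ as) (refl ∷ s) ((z , u , refl) ∷ qs)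
    with zs , eq₁ , eq₂ , _ ← extendWeights xs ys as s qs
    = z ∷ zs , cong (addₚ p (mulₚ p (square z) x)) eq₁ , cong (addₚ p (square z)) eq₂
    , λ _ → here (unit≢0 u)

  subsequence⇒zero : (xs : Vec (ℤₚ p) k) → HasWeightedZeroSumSubsequence p xs → ∃ (CommonZero xs)
  subsequence⇒zero xs (m , ys , nz , s , as , qs , eq₁ , eq₂)
    with zs , eq₁′ , eq₂′ , any ← extendWeights xs ys as s qs
    = zs , any nz
    , mod≡0⇒∣ (trans (mod-quad xs zs) (trans eq₁′ eq₁))
    , mod≡0⇒∣ (trans (mod-quad-1 zs) (trans eq₂′ eq₂))

  -- Sums over the box and polynomial functions of bounded degree.

  fallings : Vec ℕ k → Vec (ℤₚ p) k → ℕ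
  fallings []       []       = 1
  fallings (j ∷ js) (z ∷ zs) = falling (toℕ z) j * fallings js zs

  boxSum : (Vec (ℤₚ p) k → ℕ) → ℕ
  boxSum {zero}  g = g []
  boxSum {suc k} g = sum λ z → boxSum λ zs → g (z ∷ zs)

  boxSum-cong : {f g : Vec (ℤₚ p) k → ℕ} → f ≗ g → boxSum f ≡ boxSum g
  boxSum-cong {zero}  f≗g = f≗g []
  boxSum-cong {suc k} f≗g = sum-cong-≗ {p} λ z → boxSum-cong λ zs → f≗g (z ∷ zs)

  boxSum-+ : (f g : Vec (ℤₚ p) k → ℕ) → boxSum (λ zs → f zs + g zs) ≡ boxSum f + boxSum g
  boxSum-+ {zero}  f g = refl
  boxSum-+ {suc k} f g =
    trans (sum-cong-≗ {p} λ z → boxSum-+ (λ zs → f (z ∷ zs)) (λ zs → g (z ∷ zs)))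
      (∑-distrib-+ {p} (λ z → boxSum λ zs → f (z ∷ zs)) (λ z → boxSum λ zs → g (z ∷ zs)))

  boxSum-* : ∀ c (g : Vec (ℤₚ p) k → ℕ) → boxSum (λ zs → c * g zs) ≡ c * boxSum g
  boxSum-* {zero}  c g = refl
  boxSum-* {suc k} c g =
    trans (sum-cong-≗ {p} λ z → boxSum-* c (λ zs → g (z ∷ zs)))
      (sym (*-distribˡ-sum {p} c (λ z → boxSum λ zs → g (z ∷ zs))))

  ∣-boxSum : ∀ {d} (g : Vec (ℤₚ p) k → ℕ) → (∀ zs → d ∣ g zs) → d ∣ boxSum g
  ∣-boxSum {zero}  g d∣g = d∣g []
  ∣-boxSum {suc k} g d∣g = ∣sum _ λ z → ∣-boxSum (λ zs → g (z ∷ zs)) (λ zs → d∣g (z ∷ zs))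

  -- One coordinate at a time: the slices with nonzero first coordinate contribute multiples of `d`,
  -- so the slice at 0 must as well.
  ∣-boxSum⇒∣-origin : ∀ {d} (g : Vec (ℤₚ p) k → ℕ) → (∀ zs → Any (_≢ 0ₚ p) zs → d ∣ g zs) →
                      d ∣ boxSum g → d ∣ g (replicate k (0ₚ p))
  ∣-boxSum⇒∣-origin {zero}  g d∣g d∣S = d∣S
  ∣-boxSum⇒∣-origin {suc k} {d} g d∣g d∣S =
    ∣-boxSum⇒∣-origin (λ zs → g (0ₚ p ∷ zs)) (λ zs any → d∣g _ (there any))
      (∣m+n∣m⇒∣n (subst (d ∣_) (+-comm (boxSum λ zs → g (0ₚ p ∷ zs)) _) d∣S)
        (∣sum _ λ z → ∣-boxSum (λ zs → g (suc z ∷ zs)) (λ zs → d∣g _ (here λ ()))))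

  -- Polynomial functions in the basis of products of falling factorials, whose
  -- sums over the box have a closed form.
  data Degree≤ {k} (d : ℕ) : (Vec (ℤₚ p) k → ℕ) → Set where
    basis : ∀ js → Vec.sum js ≤ d → Degree≤ d (fallings js)
    _⊕_   : ∀ {f g} → Degree≤ d f → Degree≤ d g → Degree≤ d (λ zs → f zs + g zs)
    scale : ∀ c {g} → Degree≤ d g → Degree≤ d (λ zs → c * g zs)
    ext   : ∀ {f g} → f ≗ g → Degree≤ d f → Degree≤ d g

  weaken : ∀ {d e} {g : Vec (ℤₚ p) k → ℕ} → d ≤ e → Degree≤ d g → Degree≤ e g
  weaken d≤e (basis js js≤d) = basis js (≤-trans js≤d d≤e)
  weaken d≤e (f ⊕ g)         = weaken d≤e f ⊕ weaken d≤e g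
  weaken d≤e (scale c g)     = scale c (weaken d≤e g)
  weaken d≤e (ext f≗g f)     = ext f≗g (weaken d≤e f)

  Degree≤-1 : Degree≤ {k} 0 (λ _ → 1)
  Degree≤-1 {k} = ext fallings-0 (basis (replicate k 0) (≤-reflexive (sum-0 k)))
    where
    sum-0 : ∀ k → Vec.sum (replicate k 0) ≡ 0
    sum-0 zero    = refl
    sum-0 (suc k) = sum-0 k
    fallings-0 : ∀ {k} (zs : Vec (ℤₚ p) k) → fallings (replicate k 0) zs ≡ 1
    fallings-0 []       = refl
    fallings-0 (z ∷ zs) = trans (*-identityˡ _) (fallings-0 zs)

  Degree≤-sum : ∀ {d m} (g : Fin m → Vec (ℤₚ p) k → ℕ) → (∀ i → Degree≤ d (g i)) →
                Degree≤ d (λ zs → sum λ i → g i zs)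
  -- The empty sum is 0 times the constant 1.
  Degree≤-sum {m = zero}  g dg = scale 0 (weaken z≤n Degree≤-1)
  Degree≤-sum {m = suc m} g dg = dg zero ⊕ Degree≤-sum (g ∘ suc) (dg ∘ suc)

  -- This is `*-falling` in coordinate `i`: multiplying a basis element by a coordinate gives a
  -- combination of basis elements, with degree raised by at most one.
  lookup-*-fallings : (js : Vec ℕ k) (i : Fin k) (zs : Vec (ℤₚ p) k) →
    fallings (updateAt js i suc) zs + lookup js i * fallings js zs
      ≡ toℕ (lookup zs i) * fallings js zs
  lookup-*-fallings (j ∷ js) zero (z ∷ zs) = begin
    falling (toℕ z) (suc j) * F + j * (falling (toℕ z) j * F)
      ≡⟨ factor (falling (toℕ z) (suc j)) j (falling (toℕ z) j) F ⟩
    (falling (toℕ z) (suc j) + j * falling (toℕ z) j) * F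
      ≡⟨ cong (_* F) (*-falling (toℕ z) j) ⟨
    toℕ z * falling (toℕ z) j * F
      ≡⟨ *-assoc (toℕ z) _ F ⟩
    toℕ z * (falling (toℕ z) j * F) ∎
    where
    open ≡-Reasoning
    F = fallings js zs
    factor : ∀ a j b c → a * c + j * (b * c) ≡ (a + j * b) * c
    factor = solve-∀
  lookup-*-fallings (j ∷ js) (suc i) (z ∷ zs) = begin
    a * fallings (updateAt js i suc) zs + lookup js i * (a * fallings js zs)
      ≡⟨ factor a _ (lookup js i) (fallings js zs) ⟩
    a * (fallings (updateAt js i suc) zs + lookup js i * fallings js zs)
      ≡⟨ cong (a *_) (lookup-*-fallings js i zs) ⟩
    a * (toℕ (lookup zs i) * fallings js zs)
      ≡⟨ swap a (toℕ (lookup zs i)) (fallings js zs) ⟩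
    toℕ (lookup zs i) * (a * fallings js zs) ∎
    where
    open ≡-Reasoning
    a = falling (toℕ z) j
    factor : ∀ a b c d → a * b + c * (a * d) ≡ a * (b + c * d)
    factor = solve-∀
    swap : ∀ a b c → a * (b * c) ≡ b * (a * c)
    swap = solve-∀

  sum-updateAt-suc : (js : Vec ℕ k) (i : Fin k) → Vec.sum (updateAt js i suc) ≡ suc (Vec.sum js)
  sum-updateAt-suc (j ∷ js) zero    = refl
  sum-updateAt-suc (j ∷ js) (suc i) =
    trans (cong (j +_) (sum-updateAt-suc js i)) (+-suc j (Vec.sum js))

  Degree≤-lookup : ∀ {d} {g : Vec (ℤₚ p) k → ℕ} i → Degree≤ d g →
                   Degree≤ (suc d) (λ zs → toℕ (lookup zs i) * g zs)
  Degree≤-lookup i (basis js js≤d) = ext (lookup-*-fallings js i)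
    (basis (updateAt js i suc) (≤-trans (≤-reflexive (sum-updateAt-suc js i)) (s≤s js≤d))
     ⊕ scale (lookup js i) (basis js (m≤n⇒m≤1+n js≤d)))
  Degree≤-lookup i (_⊕_ {f} {g} df dg) =
    ext (λ zs → sym (*-distribˡ-+ (toℕ (lookup zs i)) (f zs) (g zs)))
      (Degree≤-lookup i df ⊕ Degree≤-lookup i dg)
  Degree≤-lookup i (scale c {g} dg) =
    ext (λ zs → swap c (toℕ (lookup zs i)) (g zs)) (scale c (Degree≤-lookup i dg))
    where
    swap : ∀ a b c → a * (b * c) ≡ b * (a * c)
    swap = solve-∀
  Degree≤-lookup i (ext f≗g df) =
    ext (λ zs → cong (toℕ (lookup zs i) *_) (f≗g zs)) (Degree≤-lookup i df)

  -- Each term of the form acts as two successive multiplications by a coordinate, so products grow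
  -- factor by factor and two expansions in the basis are never multiplied together.
  Degree≤-quad : ∀ {d} {g : Vec (ℤₚ p) k → ℕ} (c : Fin k → ℕ) → Degree≤ d g →
                 Degree≤ (2 + d) (λ zs → quad c zs * g zs)
  Degree≤-quad {k} {g = g} c dg = ext
    (λ zs → sym (*-distribʳ-sum {k} (g zs) (λ i → c i * (toℕ (lookup zs i) * toℕ (lookup zs i)))))
    (Degree≤-sum _ λ i → ext (λ zs → reassoc (c i) (toℕ (lookup zs i)) (g zs))
      (scale (c i) (Degree≤-lookup i (Degree≤-lookup i dg))))
    where
    reassoc : ∀ a b c → a * (b * (b * c)) ≡ a * (b * b) * c
    reassoc = solve-∀

  Degree≤-rise-quad : ∀ {d} {g : Vec (ℤₚ p) k → ℕ} (c : Fin k → ℕ) r → Degree≤ d g →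
                      Degree≤ (r * 2 + d) (λ zs → rise r (quad c zs) * g zs)
  Degree≤-rise-quad {g = g} c zero    dg = ext (λ zs → sym (*-identityˡ (g zs))) dg
  Degree≤-rise-quad {g = g} c (suc r) dg =
    ext (λ zs → factor (quad c zs) (suc r) (rise r (quad c zs)) (g zs))
      (Degree≤-quad c ih ⊕ scale (suc r) (weaken (m≤n+m _ 2) ih))
    where
    ih = Degree≤-rise-quad c r dg
    factor : ∀ f s a b → f * (a * b) + s * (a * b) ≡ (f + s) * a * b
    factor = solve-∀

  -- Inverses modulo a prime, and subsequences from common zeros.

  module _ (p-prime : Prime p) where

    inverse : (x : ℤₚ p) → x ≢ 0ₚ p → ∃[ w ] ∃[ l ] w * toℕ x ≡ 1 + l * p
    inverse zero      x≢0 = contradiction refl x≢0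
    inverse x@(suc _) x≢0 with coprime-Bézout (prime⇒coprime p-prime (toℕ<n x))
    ... | Bézout.-+ a b eq = b , a , sym eq
    -- Here b x ≡ -1 modulo p, so b is multiplied by p - 1 ≡ -1. Adding p to both sides avoids a
    -- subtraction in the quotient.
    ... | Bézout.+- (suc a) b eq = suc q * b , q + suc q * a , +-cancelʳ-≡ p _ _ (begin
      suc q * b * toℕ x + p                 ≡⟨ regroup q b (toℕ x) ⟩
      1 + suc q * (1 + b * toℕ x)           ≡⟨ cong (λ y → 1 + suc q * y) eq ⟩
      1 + suc q * (suc a * p)               ≡⟨ split q a p ⟩
      1 + suc q * a * p + suc q * p         ≡⟨ collect q a p ⟩
      1 + (q + suc q * a) * p + p           ∎)
      where
      open ≡-Reasoning
      regroup : ∀ q b x → suc q * b * x + suc (suc q) ≡ 1 + suc q * (1 + b * x)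
      regroup = solve-∀
      split : ∀ q a p → 1 + suc q * (suc a * p) ≡ 1 + suc q * a * p + suc q * p
      split = solve-∀
      collect : ∀ q a p → 1 + suc q * a * p + suc q * p ≡ 1 + (q + suc q * a) * p + p
      collect = solve-∀

    ≢0⇒unit : (x : ℤₚ p) → x ≢ 0ₚ p → IsUnit p x
    ≢0⇒unit x x≢0 with w , l , eq ← inverse x x≢0 = w mod p , wx≡1 ,
      trans (cong (_mod p) (*-comm (toℕ x) (toℕ (w mod p)))) wx≡1
      where
      open ≡-Reasoning
      wx≡1 : mulₚ p (w mod p) x ≡ 1ₚ p
      wx≡1 = begin
        mulₚ p (w mod p) x               ≡⟨ cong (mulₚ p (w mod p)) (mod-toℕ x) ⟨
        mulₚ p (w mod p) (toℕ x mod p)   ≡⟨ mod-* w (toℕ x) ⟨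
        (w * toℕ x) mod p                ≡⟨ cong (_mod p) eq ⟩
        (1 + l * p) mod p                ≡⟨ mod-cong (1 + l * p) 1 ([m+kn]%n≡m%n 1 l p) ⟩
        1 mod p                          ∎

    -- Converse to `extendWeights`: terms with coordinate 0 are dropped, and every other coordinate
    -- is a unit, so its square is an admissible weight.
    support : (xs zs : Vec (ℤₚ p) k) →
      ∃[ m ] ∃[ ys ] ∃[ as ] toList {n = m} ys ⊆ toList xs × All (Q p) as
        × weightedSum as ys ≡ weightedSum (map square zs) xs
        × sumₚ p as ≡ sumₚ p (map square zs)
        × (Any (_≢ 0ₚ p) zs → NonZero m)
    support []       []       = 0 , [] , [] , [] , [] , refl , refl , λ ()
    support (x ∷ xs) (z ∷ zs) with support xs zs | z ≟ᶠ 0ₚ p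
    ... | m , ys , as , s , qs , eq₁ , eq₂ , nz | yes refl =
      m , ys , as , x ∷ʳ s , qs
      , trans eq₁ (sym (addₚ-identityˡ _)) , trans eq₂ (sym (addₚ-identityˡ _))
      , λ { (here z≢0) → contradiction refl z≢0 ; (there any) → nz any }
    ... | m , ys , as , s , qs , eq₁ , eq₂ , nz | no z≢0 =
      suc m , x ∷ ys , square z ∷ as , refl ∷ s , (z , ≢0⇒unit z z≢0 , refl) ∷ qs
      , cong (addₚ p (mulₚ p (square z) x)) eq₁ , cong (addₚ p (square z)) eq₂ , _

    zero⇒subsequence : (xs : Vec (ℤₚ p) k) → ∃ (CommonZero xs) → HasWeightedZeroSumSubsequence p xs
    zero⇒subsequence xs (zs , any , p∣₁ , p∣₂)
      with m , ys , as , s , qs , eq₁ , eq₂ , nz ← support xs zs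
      = m , ys , nz any , s , as , qs
      , trans eq₁ (trans (sym (mod-quad xs zs)) (∣⇒mod≡0 p∣₁))
      , trans eq₂ (trans (sym (mod-quad-1 zs)) (∣⇒mod≡0 p∣₂))

    commonZero? : (xs : Vec (ℤₚ p) k) → Dec (∃ (CommonZero xs))
    commonZero? xs = any-vec? λ zs →
      Any.any? (λ z → ¬? (z ≟ᶠ 0ₚ p)) zs ×-dec (p ∣? _) ×-dec (p ∣? _)

    hasSubsequence? : (xs : Vec (ℤₚ p) k) → Dec (HasWeightedZeroSumSubsequence p xs)
    hasSubsequence? xs = map′ (zero⇒subsequence xs) (subsequence⇒zero xs) (commonZero? xs)

    -- The Chevalley-Warning argument.

    -- Modulo p the factors are 1, ..., r, all nonzero, and p is prime.
    ∤rise : ∀ {m} r → p ∣ m → r < p → p ∤ rise r m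
    ∤rise {m} zero    p∣m r<p = >⇒∤ {1} (s≤s (s≤s z≤n))
    ∤rise {m} (suc r) p∣m r<p =
      [ (λ p∣ → >⇒∤ r<p (∣m+n∣m⇒∣n p∣ p∣m)) , ∤rise r p∣m (<⇒≤ r<p) ]′
        ∘ euclidsLemma (m + suc r) (rise r m) p-prime

    ∣rise : ∀ {m} → p ∤ m → p ∣ rise (suc q) m
    ∣rise {m} p∤m with m % p in eq | m%n<n m p
    ... | zero  | _     = contradiction (m%n≡0⇒n∣m m p eq) p∤m
    -- With remainder r + 1, the factor m + (p - (r + 1)) is a multiple of p, and p - (r + 1) = (q -
    -- r) + 1.
    ... | suc r | s≤s r<1+q = ∣-trans (divides (1 + m / p) (begin
      m + suc (q ∸ r)                        ≡⟨ cong (_+ suc (q ∸ r)) (m≡m%n+[m/n]*n m p) ⟩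
      m % p + m / p * p + suc (q ∸ r)        ≡⟨ cong (λ x → x + m / p * p + suc (q ∸ r)) eq ⟩
      suc r + m / p * p + suc (q ∸ r)        ≡⟨ regroup r (m / p * p) (q ∸ r) ⟩
      suc (suc (r + (q ∸ r))) + m / p * p    ≡⟨ cong (λ x → suc (suc x) + m / p * p) (m+[n∸m]≡n (≤-pred r<1+q)) ⟩
      (1 + m / p) * p ∎)) (+∣rise m (s≤s (m∸n≤m q r)))
      where
      open ≡-Reasoning
      regroup : ∀ r a s → suc r + a + suc s ≡ suc (suc (r + s)) + a
      regroup = solve-∀

    -- By `sum-falling`, j + 1 times the sum is a falling factorial with leading factor p, while 0 <
    -- j + 1 < p. This is the analogue of vanishing power sums.
    ∣sum-falling : ∀ {j} → j < suc q → p ∣ sum {p} (λ z → falling (toℕ z) j)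
    ∣sum-falling {j} j<1+q =
      [ (λ p∣ → contradiction p∣ (>⇒∤ (s≤s j<1+q))) , (λ p∣ → p∣) ]′
        (euclidsLemma (suc j) _ p-prime
          (subst (p ∣_) (sym (sum-falling p j)) (m∣m*n (falling (suc q) j))))

    -- The sum factors over the coordinates, and a total degree below k(p - 1) forces some exponent
    -- below p - 1.
    ∣boxSum-fallings : (js : Vec ℕ k) → Vec.sum js < k * suc q → p ∣ boxSum (fallings js)
    ∣boxSum-fallings {suc k} (j ∷ js) js< = subst (p ∣_) (sym product) p∣product
      where
      F = boxSum (fallings js)
      product : boxSum (fallings (j ∷ js)) ≡ sum {p} (λ z → falling (toℕ z) j) * F
      product = trans (sum-cong-≗ {p} λ z → boxSum-* (falling (toℕ z) j) (fallings js))
        (sym (*-distribʳ-sum {p} F (λ z → falling (toℕ z) j)))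
      p∣product : p ∣ sum {p} (λ z → falling (toℕ z) j) * F
      p∣product with j <? suc q
      ... | yes j<1+q = ∣m⇒∣m*n F (∣sum-falling j<1+q)
      ... | no  j≮1+q = ∣n⇒∣m*n (sum {p} (λ z → falling (toℕ z) j)) (∣boxSum-fallings js
        (+-cancelˡ-< (suc q) _ _ (≤-<-trans (+-monoˡ-≤ (Vec.sum js) (≮⇒≥ j≮1+q)) js<)))

    ∣boxSum : ∀ {d} {g : Vec (ℤₚ p) k → ℕ} → Degree≤ d g → d < k * suc q → p ∣ boxSum g
    ∣boxSum (basis js js≤d)     d< = ∣boxSum-fallings js (≤-<-trans js≤d d<)
    ∣boxSum (_⊕_ {f} {g} df dg) d< =
      subst (p ∣_) (sym (boxSum-+ f g)) (∣m∣n⇒∣m+n (∣boxSum df d<) (∣boxSum dg d<))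
    ∣boxSum (scale c {g} dg)    d< = subst (p ∣_) (sym (boxSum-* c g)) (∣n⇒∣m*n c (∣boxSum dg d<))
    ∣boxSum (ext f≗g df)        d< = subst (p ∣_) (boxSum-cong f≗g) (∣boxSum df d<)

    commonZero-exists : 4 < k → (xs : Vec (ℤₚ p) k) → ∃ (CommonZero xs)
    commonZero-exists {k} 4<k xs = decidable-stable (commonZero? xs) λ ¬zero →
      p∤P0 (∣-boxSum⇒∣-origin P (p∣P ¬zero) (∣boxSum degree degree<))
      where
      f g P : Vec (ℤₚ p) k → ℕ
      f = quad (coefficients xs)
      g = quad (λ _ → 1)
      -- The trailing 1 is the constant from which the degree bound is built up.
      P zs = rise (suc q) (f zs) * (rise (suc q) (g zs) * 1)
      degree : Degree≤ (suc q * 2 + (suc q * 2 + 0)) P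
      degree = Degree≤-rise-quad (coefficients xs) (suc q) (Degree≤-rise-quad (λ _ → 1) (suc q) Degree≤-1)
      degree< : suc q * 2 + (suc q * 2 + 0) < k * suc q
      degree< = ≤-trans (s≤s (≤-trans (≤-reflexive (quadruple q)) (m≤n+m _ q))) (*-monoˡ-≤ (suc q) 4<k)
        where
        quadruple : ∀ q → suc q * 2 + (suc q * 2 + 0) ≡ 4 * suc q
        quadruple = solve-∀
      p∣P : ¬ ∃ (CommonZero xs) → ∀ zs → Any (_≢ 0ₚ p) zs → p ∣ P zs
      p∣P ¬zero zs any with p ∣? f zs | p ∣? g zs
      ... | no p∤f  | _       = ∣m⇒∣m*n _ (∣rise p∤f)
      ... | yes _   | no p∤g  = ∣n⇒∣m*n (rise (suc q) (f zs)) (∣m⇒∣m*n 1 (∣rise p∤g))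
      ... | yes p∣f | yes p∣g = contradiction (zs , any , p∣f , p∣g) ¬zero
      p∤rise0 : (c : Fin k → ℕ) → p ∤ rise (suc q) (quad c (replicate k (0ₚ p)))
      p∤rise0 c = ∤rise (suc q) (subst (p ∣_) (sym (quad-replicate-0 c)) (p ∣0)) (n<1+n _)
      p∤P0 : p ∤ P (replicate k (0ₚ p))
      p∤P0 p∣P0 = [ p∤rise0 (coefficients xs)
                  , p∤rise0 (λ _ → 1) ∘ subst (p ∣_) (*-identityʳ (rise (suc q) (g (replicate k (0ₚ p))))) ]′
        (euclidsLemma (rise (suc q) (f (replicate k (0ₚ p)))) _ p-prime p∣P0)

    -- A sequence of length three without a weighted zero-sum subsequence.

    -- t is a value missed by x ↦ −x².
    nonsquare : 2 ∤ p → ∃[ t ] ∀ m → p ∤ m * m + toℕ {p} t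
    nonsquare 2∤p = map₂ (λ {t} → avoid t)
      -- As p is odd, 1 and -1 are distinct with equal squares, so the map is not injective.
      (missed-value minusSquare 1≢-1 (cong (mulₚ p -1ₚ) square1≡square-1))
      where
      -1ₚ : ℤₚ p
      -1ₚ = suc q mod p
      minusSquare : ℤₚ p → ℤₚ p
      minusSquare x = mulₚ p -1ₚ (square x)
      1≢-1 : 1ₚ p ≢ -1ₚ
      1≢-1 eq = 2∤p (∣-reflexive (cong suc
        (trans (cong toℕ eq) (trans (toℕ-mod (suc q)) (m<n⇒m%n≡m (n<1+n (suc q)))))))
      square1≡square-1 : square (1ₚ p) ≡ square -1ₚ
      square1≡square-1 = begin
        square (1ₚ p)                  ≡⟨ mod-* 1 1 ⟨
        1 mod p                        ≡⟨ mod-cong (1 + q * p) 1 ([m+kn]%n≡m%n 1 q p) ⟨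
        (1 + q * p) mod p              ≡⟨ cong (_mod p) (expand q) ⟩
        (suc q * suc q) mod p          ≡⟨ mod-* (suc q) (suc q) ⟩
        square -1ₚ                     ∎
        where
        open ≡-Reasoning
        expand : ∀ q → 1 + q * suc (suc q) ≡ suc q * suc q
        expand = solve-∀
      -- Multiplication by p - 1 serves as negation: s ≡ -t gives -s ≡ t.
      cancel : ∀ s t → p ∣ s + t → (suc q * s) % p ≡ t % p
      cancel s t (divides c eq) = begin
        (suc q * s) % p             ≡⟨ [m+kn]%n≡m%n (suc q * s) c p ⟨
        (suc q * s + c * p) % p     ≡⟨ cong (λ x → (suc q * s + x) % p) eq ⟨
        (suc q * s + (s + t)) % p   ≡⟨ cong (_% p) (collect q s t) ⟩
        (t + s * p) % p             ≡⟨ [m+kn]%n≡m%n t s p ⟩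
        t % p                       ∎
        where
        open ≡-Reasoning
        collect : ∀ q s t → suc q * s + (s + t) ≡ t + s * suc (suc q)
        collect = solve-∀
      avoid : ∀ t → (∀ x → minusSquare x ≢ t) → ∀ m → p ∤ m * m + toℕ {p} t
      avoid t t-missed m p∣ = t-missed (m mod p) (begin
        mulₚ p -1ₚ (square (m mod p))        ≡⟨ cong (mulₚ p -1ₚ) (mod-* m m) ⟨
        mulₚ p -1ₚ ((m * m) mod p)           ≡⟨ mod-* (suc q) (m * m) ⟨
        (suc q * (m * m)) mod p              ≡⟨ mod-cong (suc q * (m * m)) (toℕ t) (cancel (m * m) (toℕ t) p∣) ⟩
        toℕ t mod p                          ≡⟨ mod-toℕ t ⟩
        t                                    ∎)
        where open ≡-Reasoning

    ∣square⇒≡0 : ∀ x → p ∣ toℕ x * toℕ x → x ≡ 0ₚ p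
    ∣square⇒≡0 x p∣xx = trans (sym (mod-toℕ x))
      (∣⇒mod≡0 ([ (λ p∣x → p∣x) , (λ p∣x → p∣x) ]′ (euclidsLemma (toℕ x) (toℕ x) p-prime p∣xx)))

    -- For c ≠ 0, dividing b² + t c² ≡ 0 by c² would make -t a square. For c = 0, the first form
    -- forces b = 0, and then the second forces a = 0.
    ¬commonZero : ∀ t → (∀ m → p ∤ m * m + toℕ t) → ¬ ∃ (CommonZero (0ₚ p ∷ 1ₚ p ∷ t ∷ []))
    ¬commonZero t -t-nonsquare (a ∷ b ∷ c ∷ [] , any , p∣f , p∣g) with c ≟ᶠ 0ₚ p
    ... | no c≢0 with w , l , eq ← inverse c c≢0 = -t-nonsquare (w * toℕ b)
      -- Since w c = 1 + l p, the product of w² and the first form is (w b)² + t plus a multiple of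
      -- p.
      (∣m+n∣m⇒∣n (subst (p ∣_) identity (∣n⇒∣m*n (w * w) p∣f))
        (n∣m*n (toℕ t * (2 * l + l * l * p))))
      where
      open ≡-Reasoning
      expand : ∀ w b c t → w * w * (1 * (b * b) + (t * (c * c) + 0)) ≡ w * b * (w * b) + t * (w * c * (w * c))
      expand = solve-∀
      collect : ∀ l p t s → s + t * ((1 + l * p) * (1 + l * p)) ≡ t * (2 * l + l * l * p) * p + (s + t)
      collect = solve-∀
      identity : w * w * (1 * (toℕ b * toℕ b) + (toℕ t * (toℕ c * toℕ c) + 0))
               ≡ toℕ t * (2 * l + l * l * p) * p + (w * toℕ b * (w * toℕ b) + toℕ t)
      identity = begin
        w * w * (1 * (toℕ b * toℕ b) + (toℕ t * (toℕ c * toℕ c) + 0))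
          ≡⟨ expand w (toℕ b) (toℕ c) (toℕ t) ⟩
        w * toℕ b * (w * toℕ b) + toℕ t * (w * toℕ c * (w * toℕ c))
          ≡⟨ cong (λ x → w * toℕ b * (w * toℕ b) + toℕ t * (x * x)) eq ⟩
        w * toℕ b * (w * toℕ b) + toℕ t * ((1 + l * p) * (1 + l * p))
          ≡⟨ collect l p (toℕ t) (w * toℕ b * (w * toℕ b)) ⟩
        toℕ t * (2 * l + l * l * p) * p + (w * toℕ b * (w * toℕ b) + toℕ t) ∎
    ... | yes refl = all-zero a≡0 b≡0 any
      where
      simplify : ∀ b t → 1 * (b * b) + (t * 0 + 0) ≡ b * b
      simplify = solve-∀
      b≡0 : b ≡ 0ₚ p
      b≡0 = ∣square⇒≡0 b (subst (p ∣_) (simplify (toℕ b) (toℕ t)) p∣f)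
      a≡0 : a ≡ 0ₚ p
      a≡0 = ∣square⇒≡0 a (subst (p ∣_) (simplify (toℕ a) 0)
        (subst (λ z → p ∣ 1 * (toℕ a * toℕ a) + (1 * (toℕ z * toℕ z) + 0)) b≡0 p∣g))
      all-zero : ∀ {a b} → a ≡ 0ₚ p → b ≡ 0ₚ p → ¬ Any (_≢ 0ₚ p) (a ∷ b ∷ 0ₚ p ∷ [])
      all-zero a≡0 b≡0 (here a≢0)                 = a≢0 a≡0
      all-zero a≡0 b≡0 (there (here b≢0))         = b≢0 b≡0
      all-zero a≡0 b≡0 (there (there (here 0≢0))) = 0≢0 refl

  -- Monotonicity in the length, and the two possible values.

  -- D_{Q_p,𝟏} ≤ k
  Bounds : ℕ → Set
  Bounds k = (xs : Vec (ℤₚ p) k) → HasWeightedZeroSumSubsequence p xs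

  bounds-suc : Bounds k → Bounds (suc k)
  bounds-suc b (x ∷ xs) with m , ys , nz , s , sol ← b xs = m , ys , nz , x ∷ʳ s , sol

  bounds-+ : ∀ i → Bounds k → Bounds (i + k)
  bounds-+ zero    b = b
  bounds-+ (suc i) b = bounds-suc (bounds-+ i b)

  -- `Bounds` passes to larger lengths, so its failure at `k` excludes every j ≤ k.
  least : ¬ Bounds k → Bounds (suc k) → IsDQ𝟏 p (suc k)
  least {k} ¬b b = s≤s z≤n , b , λ j _ bj → ≰⇒> λ j≤k →
    ¬b (subst Bounds (m∸n+n≡m j≤k) (bounds-+ (k ∸ j) bj))

  module _ (p-prime : Prime p) (2∤p : 2 ∤ p) where

    ¬bounds-3 : ¬ Bounds 3
    ¬bounds-3 b = refute (nonsquare p-prime 2∤p)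
      where
      refute : ¬ (∃[ t ] ∀ m → p ∤ m * m + toℕ {p} t)
      refute (t , -t-nonsquare) = ¬commonZero p-prime t -t-nonsquare (subsequence⇒zero xs (b xs))
        where
        xs : Vec (ℤₚ p) 3
        xs = 0ₚ p ∷ 1ₚ p ∷ t ∷ []

    bounds-5 : Bounds 5
    bounds-5 xs = zero⇒subsequence p-prime xs (commonZero-exists p-prime ≤-refl xs)

    D≡4⊎5 : IsDQ𝟏 p 4 ⊎ IsDQ𝟏 p 5
    D≡4⊎5 = choose (all-vec? {k = 4} (hasSubsequence? p-prime))
      where
      choose : Dec (Bounds 4) → IsDQ𝟏 p 4 ⊎ IsDQ𝟏 p 5
      choose (yes b) = inj₁ (least ¬bounds-3 b)
      choose (no ¬b) = inj₂ (least ¬b bounds-5)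

theorem4p2 : (p : ℕ) .{{_ : NonZero p}} → Prime p → 2 ∤ p → IsDQ𝟏 p 4 ⊎ IsDQ𝟏 p 5
theorem4p2 0             p-prime _   = contradiction p-prime ¬prime[0]
theorem4p2 1             p-prime _   = contradiction p-prime ¬prime[1]
theorem4p2 (suc (suc q)) p-prime 2∤p = Residues.D≡4⊎5 q p-prime 2∤p
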